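{- Let $k\geq 1$ be an integer. For every graph $G$ with minimum degree $\delta(G)\geq k-1$ and maximum degree $\Delta(G)$, $$\gamma_{kS}(G) \geq |V(G)|\cdot\frac{\delta(G)-\Delta(G)+2k+I_{\delta(G)}+I_{\Delta(G)}}{\delta(G)+\Delta(G)+2+I_{\delta(G)}-I_{\Delta(G)}}\;.$$
   Context: All graphs are finite, simple and undirected, with nonempty vertex set. For each integer $n$, $I_n=1$ if $n\equiv k\pmod 2$, and $I_n=0$ otherwise. For a vertex $v$ of $G$, $N_G[v]$ denotes the closed neighborhood of $v$ (the set consisting of $v$ and all vertices adjacent to $v$). For $G$ of minimum degree at least $k-1$, a function $f:V(G)\rightarrow\{ -1,1\}$ is a signed $k$-dominating function of $G$ if $\sum_{u\in N_G[v]}f(u)\geq k$ for all $v\in V(G)$. The signed $k$-domination number $\gamma_{kS}(G)$ is the minimum of $\sum_{v\in V(G)}f(v)$ over all signed $k$-dominating functions $f$ of $G$. -}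

module Defs where

open import Algebra.Properties.CommutativeMonoid.Sum as Sum using ()
open import Data.Bool.Base using (true; false; if_then_else_)
open import Data.Empty using (⊥-elim)
open import Data.Fin.Base using (Fin; zero; suc)
open import Data.Fin.Properties using (all?)
open import Data.Fin.Subset using (Subset; ⁅_⁆; _∪_; ∣_∣; inside; outside)
open import Data.Fin.Subset.Properties using (∪-identityˡ)
open import Data.Integer.Base as ℤ using (ℤ; +_; 0ℤ; 1ℤ)
open import Data.Integer.Divisibility.Signed using (_∣?_)
open import Data.Integer.Properties as ℤₚ using ()
open import Data.List.Base as List using (List; []; _∷_; allFin; cartesianProductWith; filter)
open import Data.List.Extrema ℤₚ.≤-totalOrder using (argmin; argmin-all; f[argmin]≤f[xs])
open import Data.List.Extrema.Nat using (min; max; min≤xs)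
open import Data.List.Membership.Propositional using (_∈_)
open import Data.List.Membership.Propositional.Properties using (∈-cartesianProductWith⁺; ∈-filter⁺; ∈-allFin; ∈-map⁺)
open import Data.List.Relation.Unary.All as All using ()
open import Data.List.Relation.Unary.All.Properties using (all-filter)
open import Data.List.Relation.Unary.Any using (here; there)
open import Data.Nat.Base as ℕ using (ℕ; zero; suc; s≤s; _∸_)
open import Data.Nat.Properties as ℕₚ using ()
open import Data.Product.Base using (∃-syntax; _×_; _,_; proj₁; proj₂)
open import Data.Rational.Base as ℚ using (ℚ)
open import Data.Rational.Properties as ℚₚ using ()
open import Data.Sign.Base using (Sign)
open import Data.Vec.Base as Vec using ([]; _∷_; lookup)
open import Data.Vec.Properties using (lookup∘tabulate)
open import Data.Vec.Functional as Vector using (Vector)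
open import Function.Base using (_∘_)
open import Level using (0ℓ)
open import Relation.Binary.Core using (Rel)
open import Relation.Binary.Definitions using (Decidable; Symmetric; Irreflexive)
open import Relation.Binary.PropositionalEquality.Core using (_≡_; _≗_; refl; sym; trans; cong; subst)
open import Relation.Nullary.Decidable.Core using (Dec; does; yes; no; ⌊_⌋)

open Sum ℤₚ.+-0-commutativeMonoid using (sum; sum-cong-≗; sum-syntax)

-- Finite simple graphs with nonempty vertex set Fin (suc m).
record Graph : Set₁ where
  field
    m      : ℕ
    Adj    : Rel (Fin (suc m)) 0ℓ
    adj?   : Decidable Adj
    symm   : Symmetric Adj
    irrefl : Irreflexive _≡_ Adj

  order : ℕ
  order = suc m

  V : Set
  V = Fin order

  N : V → Subset order
  N v = Vec.tabulate (λ u → does (adj? v u))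

  N[_] : V → Subset order
  N[ v ] = ⁅ v ⁆ ∪ N v

  degree : V → ℕ
  degree v = ∣ N v ∣

  -- The first argument is the value min and max take on the empty list;
  -- being the degree of a vertex, it does not affect the result.
  δ Δ : ℕ
  δ = min (degree zero) (List.map degree (allFin order))
  Δ = max (degree zero) (List.map degree (allFin order))

open Graph using (order; V; N; N[_]; degree; δ; Δ)

value : Sign → ℤ
value Sign.+ = 1ℤ
value Sign.- = ℤ.- 1ℤ

sumOver : ∀ {n} → Subset n → (Fin n → ℤ) → ℤ
sumOver {n} S f = ∑[ u < n ] (if lookup S u then f u else 0ℤ)

weight : ∀ {n} → (Fin n → Sign) → ℤ
weight {n} f = ∑[ v < n ] value (f v)

SignedDominating : ℕ → (G : Graph) → (V G → Sign) → Set
SignedDominating k G f = ∀ v → + k ℤ.≤ sumOver (N[_] G v) (value ∘ f)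

IsSignedDominationNumber : ℕ → Graph → ℤ → Set
IsSignedDominationNumber k G g =
  (∃[ f ] SignedDominating k G f × g ≡ weight f) ×
  (∀ f → SignedDominating k G f → g ℤ.≤ weight f)

-- The minimum exists: there are finitely many sign functions, and the
-- constant function 1 is dominating because |N[v]| = deg v + 1 ≥ k.

private
  sumOver-one : ∀ {n} (S : Subset n) → sumOver S (λ _ → 1ℤ) ≡ + ∣ S ∣
  sumOver-one []            = refl
  sumOver-one (inside ∷ S)  = cong (ℤ._+_ 1ℤ) (sumOver-one S)
  sumOver-one (outside ∷ S) = trans (ℤₚ.+-identityˡ _) (sumOver-one S)

  ∣⁅v⁆∪S∣ : ∀ {n} (v : Fin n) (S : Subset n) → lookup S v ≡ false → ∣ ⁅ v ⁆ ∪ S ∣ ≡ suc ∣ S ∣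
  ∣⁅v⁆∪S∣ zero    (outside ∷ S) _ = cong (suc ∘ ∣_∣) (∪-identityˡ S)
  ∣⁅v⁆∪S∣ (suc v) (outside ∷ S) p = ∣⁅v⁆∪S∣ v S p
  ∣⁅v⁆∪S∣ (suc v) (inside ∷ S)  p = cong suc (∣⁅v⁆∪S∣ v S p)

  v∉Nv : ∀ G v → lookup (N G v) v ≡ false
  v∉Nv G v = trans (lookup∘tabulate (does ∘ Graph.adj? G v) v) not-loop
    where
    not-loop : does (Graph.adj? G v v) ≡ false
    not-loop with Graph.adj? G v v
    ... | yes a = ⊥-elim (Graph.irrefl G refl a)
    ... | no _  = refl

  δ≤degree : ∀ G v → δ G ℕ.≤ degree G v
  δ≤degree G v = All.lookup (min≤xs _ _) (∈-map⁺ (degree G) (∈-allFin v))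

  const-one : ∀ {n} → Fin n → Sign
  const-one _ = Sign.+

  const-one-dominating : ∀ k G → k ∸ 1 ℕ.≤ δ G → SignedDominating k G const-one
  const-one-dominating k G h v = subst (+ k ℤ.≤_)
    (sym (trans (sumOver-one (N[_] G v)) (cong +_ (∣⁅v⁆∪S∣ v (N G v) (v∉Nv G v)))))
    (ℤ.+≤+ (ℕₚ.≤-trans (ℕₚ.m≤n+m∸n k 1) (s≤s (ℕₚ.≤-trans h (δ≤degree G v)))))

  signFunctions : ∀ n → List (Vector Sign n)
  signFunctions zero    = (λ ()) ∷ []
  signFunctions (suc n) = cartesianProductWith Vector._∷_ (Sign.+ ∷ Sign.- ∷ []) (signFunctions n)

  signFunctions-complete : ∀ {n} (f : Vector Sign n) → ∃[ g ] g ∈ signFunctions n × f ≗ g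
  signFunctions-complete {zero}  f = (λ ()) , here refl , λ ()
  signFunctions-complete {suc n} f with signFunctions-complete (f ∘ suc)
  ... | g , g∈ , f≗g =
    f zero Vector.∷ g , ∈-cartesianProductWith⁺ Vector._∷_ (sign∈ (f zero)) g∈ ,
    λ { zero → refl ; (suc i) → f≗g i }
    where
    sign∈ : ∀ s → s ∈ Sign.+ ∷ Sign.- ∷ []
    sign∈ Sign.+ = here refl
    sign∈ Sign.- = there (here refl)

  dominating? : ∀ k G f → Dec (SignedDominating k G f)
  dominating? k G f = all? (λ v → + k ℤₚ.≤? sumOver (N[_] G v) (value ∘ f))

  dominating-resp-≗ : ∀ k G {f g} → f ≗ g → SignedDominating k G f → SignedDominating k G g
  dominating-resp-≗ k G f≗g d v = subst (+ k ℤ.≤_)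
    (sum-cong-≗ (λ u → cong (λ s → if lookup (N[_] G v) u then value s else 0ℤ) (f≗g u)))
    (d v)

signedDominationNumber-exists : ∀ k G → k ∸ 1 ℕ.≤ δ G → ∃[ g ] IsSignedDominationNumber k G g
signedDominationNumber-exists k G h = weight best , (best , best-dominating , refl) , best-least
  where
  candidates : List (V G → Sign)
  candidates = filter (dominating? k G) (signFunctions (order G))

  best : V G → Sign
  best = argmin weight const-one candidates

  best-dominating : SignedDominating k G best
  best-dominating = argmin-all weight {P = SignedDominating k G}
    (const-one-dominating k G h) (all-filter (dominating? k G) (signFunctions (order G)))

  best-least : ∀ f → SignedDominating k G f → weight best ℤ.≤ weight f
  best-least f d with signFunctions-complete f
  ... | g , g∈ , f≗g = subst (weight best ℤ.≤_) (sym (sum-cong-≗ (cong value ∘ f≗g)))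
    (All.lookup (f[argmin]≤f[xs] const-one candidates)
      (∈-filter⁺ (dominating? k G) g∈ (dominating-resp-≗ k G f≗g d)))

γ : (k : ℕ) (G : Graph) → k ∸ 1 ℕ.≤ δ G → ℤ
γ k G h = proj₁ (signedDominationNumber-exists k G h)

γ-isSignedDominationNumber : ∀ k G h → IsSignedDominationNumber k G (γ k G h)
γ-isSignedDominationNumber k G h = proj₂ (signedDominationNumber-exists k G h)

-- 1 if n ≡ k (mod 2), and 0 otherwise.
I : ℕ → ℤ → ℤ
I k n = if ⌊ + 2 ∣? n ℤ.- + k ⌋ then 1ℤ else 0ℤ

fromℤ : ℤ → ℚ
fromℤ i = i ℚ./ 1

numerator : ℕ → Graph → ℤ
numerator k G =
  + δ G ℤ.- + Δ G ℤ.+ + 2 ℤ.* + k ℤ.+ I k (+ δ G) ℤ.+ I k (+ Δ G)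

denominator : ℕ → Graph → ℤ
denominator k G =
  + δ G ℤ.+ + Δ G ℤ.+ + 2 ℤ.+ I k (+ δ G) ℤ.- I k (+ Δ G)

private
  fromℤ-nonZero : ∀ i → 1ℤ ℤ.≤ i → ℚ.NonZero (fromℤ i)
  fromℤ-nonZero (+ suc n) _ = ℚₚ.pos⇒nonZero (fromℤ (+ suc n)) {{ℚₚ.normalize-pos (suc n) 1}}
  fromℤ-nonZero (+ zero) (ℤ.+≤+ ())

  0≤I : ∀ k n → 0ℤ ℤ.≤ I k n
  0≤I k n with ⌊ + 2 ∣? n ℤ.- + k ⌋
  ... | true  = ℤ.+≤+ ℕ.z≤n
  ... | false = ℤ.+≤+ ℕ.z≤n

  I≤1 : ∀ k n → I k n ℤ.≤ 1ℤ
  I≤1 k n with ⌊ + 2 ∣? n ℤ.- + k ⌋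
  ... | true  = ℤ.+≤+ (s≤s ℕ.z≤n)
  ... | false = ℤ.+≤+ ℕ.z≤n

denominator-nonZero : ∀ k G → ℚ.NonZero (fromℤ (denominator k G))
denominator-nonZero k G = fromℤ-nonZero (denominator k G)
  (ℤₚ.+-mono-≤
    (ℤₚ.+-mono-≤ (ℤ.+≤+ (ℕₚ.m≤n+m 2 (δ G ℕ.+ Δ G))) (0≤I k (+ δ G)))
    (ℤₚ.neg-mono-≤ (I≤1 k (+ Δ G))))

{-# OPTIONS --safe #-}

-- By parity, f(N[v]) ≥ k already forces f(N[v]) ≥ k + I(deg v). Summing over v
-- and counting the edges twice gives
--   Σ_u f(u) (1 + deg u) ≥ Σ_u (k + I(deg u)).
-- Since d + I(d) and d − I(d) are both nondecreasing in d, each vertex u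
-- satisfies  num + 2 f(u) (1 + deg u) ≤ den · f(u) + 2 (k + I(deg u)):  bound
-- deg u by Δ when f(u) = 1 and by δ when f(u) = −1. Summing over u leaves
-- |V| · num ≤ den · Σ f.

module Submission where

open import Defs
open import Data.Nat.Base using (ℕ; _∸_; _≤_)
open import Data.Integer.Base using (+_)
open import Data.Rational.Base using (_≥_; _*_; _÷_)
open Graph using (order; δ)

open import Algebra.Properties.CommutativeMonoid.Sum as Sum using ()
open import Algebra.Properties.Semiring.Sum as SemiringSum using ()
open import Data.Bool.Base using (false; if_then_else_)
open import Data.Fin.Base using (Fin; zero; suc)
open import Data.Fin.Subset using (Subset; ⁅_⁆; _∪_; ∣_∣; inside; outside)
open import Data.Fin.Subset.Properties using (∪-identityˡ)
open import Data.Integer.Base as ℤ using (ℤ; 0ℤ; 1ℤ)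
open import Data.Integer.Divisibility.Signed using (_∣_; _∣?_; divides; ∣⇒∣ᵤ; ∣m∣n⇒∣m+n)
open import Data.Integer.Properties as ℤₚ using ()
open import Data.Integer.Tactic.RingSolver using (solve-∀)
open import Data.List.Extrema.Nat using (min≤xs; xs≤max)
open import Data.List.Membership.Propositional.Properties using (∈-allFin; ∈-map⁺)
open import Data.List.Relation.Unary.All as All using ()
open import Data.Nat.Base as ℕ using (z≤n; s≤s)
open import Data.Nat.Divisibility using (>⇒∤)
open import Data.Nat.Properties as ℕₚ using ()
open import Data.Product.Base using (_,_)
open import Data.Rational.Base as ℚ using ()
open import Data.Rational.Properties as ℚₚ using ()
open import Data.Rational.Unnormalised.Base as ℚᵘ using (mkℚᵘ; *≤*)
open import Data.Rational.Unnormalised.Properties as ℚᵘₚ using ()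
open import Data.Sign.Base using (Sign)
open import Data.Sum.Base using (inj₁; inj₂)
open import Data.Vec.Base using ([]; _∷_; lookup)
open import Data.Vec.Properties using (lookup∘tabulate)
open import Function.Base using (_∘_)
open import Function.Bundles using (mk⇔)
open import Relation.Binary.PropositionalEquality
open import Relation.Nullary.Decidable using (does; dec-false; does-⇔; yes; no)
open import Relation.Nullary.Negation using (contradiction)

open Graph using (V; N; N[_]; degree; Δ; adj?; symm; irrefl)
open Sum ℤₚ.+-0-commutativeMonoid using (sum; sum-cong-≗; sum-syntax; ∑-comm; ∑-distrib-+)
open SemiringSum ℤₚ.+-*-semiring using (*-distribˡ-sum)

-- Integer sums over finite index sets and subsets.

sum-mono : ∀ {n} {f g : Fin n → ℤ} → (∀ i → f i ℤ.≤ g i) → sum f ℤ.≤ sum g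
sum-mono {ℕ.zero}  f≤g = ℤₚ.≤-refl
sum-mono {ℕ.suc n} f≤g = ℤₚ.+-mono-≤ (f≤g zero) (sum-mono (f≤g ∘ suc))

sum-const : ∀ n c → ∑[ i < n ] c ≡ + n ℤ.* c
sum-const ℕ.zero    c = sym (ℤₚ.*-zeroˡ c)
sum-const (ℕ.suc n) c = trans (cong (ℤ._+_ c) (sum-const n c)) (sym (ℤₚ.suc-* (+ n) c))

sum-linear : ∀ {n} a b (f g : Fin n → ℤ) →
  ∑[ i < n ] (a ℤ.* f i ℤ.+ b ℤ.* g i) ≡ a ℤ.* sum f ℤ.+ b ℤ.* sum g
sum-linear a b f g = trans (∑-distrib-+ (λ i → a ℤ.* f i) (λ i → b ℤ.* g i))
  (sym (cong₂ ℤ._+_ (*-distribˡ-sum a f) (*-distribˡ-sum b g)))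

sumOver-const : ∀ {n} (S : Subset n) c → sumOver S (λ _ → c) ≡ c ℤ.* + ∣ S ∣
sumOver-const []            c = sym (ℤₚ.*-zeroʳ c)
sumOver-const (inside ∷ S)  c =
  trans (cong (ℤ._+_ c) (sumOver-const S c)) (sym (ℤₚ.*-suc c (+ ∣ S ∣)))
sumOver-const (outside ∷ S) c = trans (ℤₚ.+-identityˡ _) (sumOver-const S c)

-- The hypothesis makes the union disjoint, so `v` adds exactly one term. It is later used with `S`
-- an open neighborhood of `v`.
sumOver-⁅v⁆∪ : ∀ {n} (v : Fin n) (S : Subset n) f → lookup S v ≡ false →
  sumOver (⁅ v ⁆ ∪ S) f ≡ f v ℤ.+ sumOver S f
sumOver-⁅v⁆∪ zero (outside ∷ S) f _ = cong (ℤ._+_ (f zero))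
  (trans (cong (λ T → sumOver T (f ∘ suc)) (∪-identityˡ S)) (sym (ℤₚ.+-identityˡ _)))
sumOver-⁅v⁆∪ (suc v) (x ∷ S) f v∉S =
  trans (cong (ℤ._+_ (if x then f zero else 0ℤ)) (sumOver-⁅v⁆∪ v S (f ∘ suc) v∉S))
    (swap (if x then f zero else 0ℤ) (f (suc v)) (sumOver S (f ∘ suc)))
  where
  swap : ∀ a b c → a ℤ.+ (b ℤ.+ c) ≡ b ℤ.+ (a ℤ.+ c)
  swap = solve-∀

-- Parity of sums of signs.

2∣value-1 : ∀ s → + 2 ∣ value s ℤ.- 1ℤ
2∣value-1 Sign.+ = divides 0ℤ refl
2∣value-1 Sign.- = divides (ℤ.- 1ℤ) refl

2∣-+ : ∀ a b c d → + 2 ∣ a ℤ.- b → + 2 ∣ c ℤ.- d → + 2 ∣ (a ℤ.+ c) ℤ.- (b ℤ.+ d)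
2∣-+ a b c d p q = subst (+ 2 ∣_) (shuffle a b c d) (∣m∣n⇒∣m+n p q)
  where
  shuffle : ∀ a b c d → (a ℤ.- b) ℤ.+ (c ℤ.- d) ≡ (a ℤ.+ c) ℤ.- (b ℤ.+ d)
  shuffle = solve-∀

-- Each term is 1 or -1, hence odd, so modulo 2 the sum only counts its terms.
sumOver-parity : ∀ {n} (S : Subset n) (f : Fin n → Sign) →
  + 2 ∣ sumOver S (value ∘ f) ℤ.- + ∣ S ∣
sumOver-parity []            f = divides 0ℤ refl
sumOver-parity (inside ∷ S)  f =
  2∣-+ (value (f zero)) 1ℤ (sumOver S (value ∘ f ∘ suc)) (+ ∣ S ∣) (2∣value-1 (f zero)) (sumOver-parity S (f ∘ suc))
sumOver-parity (outside ∷ S) f =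
  2∣-+ 0ℤ 0ℤ (sumOver S (value ∘ f ∘ suc)) (+ ∣ S ∣) (divides 0ℤ refl) (sumOver-parity S (f ∘ suc))

-- Double counting over neighborhoods, and the degree bounds.

module _ (G : Graph) where

  lookup-N : ∀ v u → lookup (N G v) u ≡ does (adj? G v u)
  lookup-N v u = lookup∘tabulate (λ u → does (adj? G v u)) u

  lookup-N-sym : ∀ v u → lookup (N G v) u ≡ lookup (N G u) v
  lookup-N-sym v u = trans (lookup-N v u)
    (trans (does-⇔ (mk⇔ (symm G) (symm G)) (adj? G v u) (adj? G u v)) (sym (lookup-N u v)))

  sumOver-N[] : ∀ v f → sumOver (N[_] G v) f ≡ f v ℤ.+ sumOver (N G v) f
  sumOver-N[] v f = sumOver-⁅v⁆∪ v (N G v) f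
    (trans (lookup-N v v) (dec-false (adj? G v v) (irrefl G refl)))

  -- Exchange the order of summation: `f u` is collected once from every `v` with `u` in `N G v`. By
  -- symmetry of adjacency these `v` are the neighbors of `u`.
  sum-N : ∀ f → ∑[ v < order G ] sumOver (N G v) f ≡ ∑[ u < order G ] (f u ℤ.* + degree G u)
  sum-N f = trans (∑-comm (λ v u → if lookup (N G v) u then f u else 0ℤ))
    (sum-cong-≗ (λ u → trans
      (sum-cong-≗ (λ v → cong (if_then f u else 0ℤ) (lookup-N-sym v u)))
      (sumOver-const (N G u) (f u))))

  sum-N[] : ∀ f →
    ∑[ v < order G ] sumOver (N[_] G v) f ≡ ∑[ u < order G ] (f u ℤ.* ℤ.suc (+ degree G u))
  sum-N[] f = begin
    ∑[ v < order G ] sumOver (N[_] G v) f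
      ≡⟨ sum-cong-≗ (λ v → sumOver-N[] v f) ⟩
    ∑[ v < order G ] (f v ℤ.+ sumOver (N G v) f)
      ≡⟨ ∑-distrib-+ f (λ v → sumOver (N G v) f) ⟩
    sum f ℤ.+ ∑[ v < order G ] sumOver (N G v) f
      ≡⟨ cong (ℤ._+_ (sum f)) (sum-N f) ⟩
    sum f ℤ.+ ∑[ u < order G ] (f u ℤ.* + degree G u)
      ≡⟨ ∑-distrib-+ f (λ u → f u ℤ.* + degree G u) ⟨
    ∑[ u < order G ] (f u ℤ.+ f u ℤ.* + degree G u)
      ≡⟨ sum-cong-≗ (λ u → sym (ℤₚ.*-suc (f u) (+ degree G u))) ⟩
    ∑[ u < order G ] (f u ℤ.* ℤ.suc (+ degree G u)) ∎
    where open ≡-Reasoning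

  δ≤degree : ∀ v → δ G ≤ degree G v
  δ≤degree v = All.lookup (min≤xs _ _) (∈-map⁺ (degree G) (∈-allFin v))

  degree≤Δ : ∀ v → degree G v ≤ Δ G
  degree≤Δ v = All.lookup (xs≤max _ _) (∈-map⁺ (degree G) (∈-allFin v))

-- Monotonicity of d + I(d) and d - I(d), and the parity gain.

0≤I : ∀ k n → 0ℤ ℤ.≤ I k n
0≤I k n with + 2 ∣? n ℤ.- + k
... | yes _ = ℤ.+≤+ z≤n
... | no _  = ℤ.+≤+ z≤n

I≤1 : ∀ k n → I k n ℤ.≤ 1ℤ
I≤1 k n with + 2 ∣? n ℤ.- + k
... | yes _ = ℤ.+≤+ (s≤s z≤n)
... | no _  = ℤ.+≤+ z≤n

-- For `m` < `n` the indicator gains at most 1 at `m` and loses nothing at `n`, and the integer gap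
-- of at least 1 absorbs this.
+I-mono : ∀ k {m n} → m ≤ n → + m ℤ.+ I k (+ m) ℤ.≤ + n ℤ.+ I k (+ n)
+I-mono k {m} {n} m≤n with ℕₚ.m≤n⇒m<n∨m≡n m≤n
... | inj₂ refl = ℤₚ.≤-refl
... | inj₁ m<n  = begin
  + m ℤ.+ I k (+ m) ≤⟨ ℤₚ.+-monoʳ-≤ (+ m) (I≤1 k (+ m)) ⟩
  + m ℤ.+ 1ℤ        ≡⟨ ℤₚ.+-comm (+ m) 1ℤ ⟩
  + ℕ.suc m         ≤⟨ ℤ.+≤+ m<n ⟩
  + n               ≡⟨ ℤₚ.+-identityʳ (+ n) ⟨
  + n ℤ.+ 0ℤ        ≤⟨ ℤₚ.+-monoʳ-≤ (+ n) (0≤I k (+ n)) ⟩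
  + n ℤ.+ I k (+ n) ∎
  where open ℤₚ.≤-Reasoning

-I-mono : ∀ k {m n} → m ≤ n → + m ℤ.- I k (+ m) ℤ.≤ + n ℤ.- I k (+ n)
-I-mono k {m} {n} m≤n with ℕₚ.m≤n⇒m<n∨m≡n m≤n
... | inj₂ refl = ℤₚ.≤-refl
... | inj₁ m<n  = begin
  + m ℤ.- I k (+ m) ≤⟨ ℤₚ.+-monoʳ-≤ (+ m) (ℤₚ.neg-mono-≤ (0≤I k (+ m))) ⟩
  + m ℤ.+ 0ℤ        ≡⟨ ℤₚ.+-identityʳ (+ m) ⟩
  -- `ℤ.pred (+ ℕ.suc m)` reduces to `+ m`; in this form `m<n` applies under the predecessor.
  ℤ.pred (+ ℕ.suc m) ≤⟨ ℤₚ.pred-mono (ℤ.+≤+ m<n) ⟩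
  ℤ.pred (+ n)      ≡⟨ ℤₚ.+-comm (ℤ.- 1ℤ) (+ n) ⟩
  + n ℤ.- 1ℤ        ≤⟨ ℤₚ.+-monoʳ-≤ (+ n) (ℤₚ.neg-mono-≤ (I≤1 k (+ n))) ⟩
  + n ℤ.- I k (+ n) ∎
  where open ℤₚ.≤-Reasoning

-- Here `d` stands for a degree and `s` for f(N[v]). If `d` has the parity of `k`, then `s`, having
-- the parity of 1 + `d`, differs from `k`, so `s` is at least `k` + 1.
k+I≤ : ∀ k d s → + k ℤ.≤ s → + 2 ∣ s ℤ.- ℤ.suc d → + k ℤ.+ I k d ℤ.≤ s
k+I≤ k d s k≤s 2∣s-1-d with + 2 ∣? d ℤ.- + k
... | no _      = subst (ℤ._≤ s) (sym (ℤₚ.+-identityʳ (+ k))) k≤s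
... | yes 2∣d-k = subst (ℤ._≤ s) (ℤₚ.+-comm 1ℤ (+ k)) (ℤₚ.i<j⇒suc[i]≤j (ℤₚ.≤∧≢⇒< k≤s k≢s))
  where
  telescope : ∀ s d e → (s ℤ.- (1ℤ ℤ.+ d)) ℤ.+ (d ℤ.- e) ≡ (s ℤ.- e) ℤ.- 1ℤ
  telescope = solve-∀
  k≢s : + k ≢ s
  -- With `s` equal to `+ k`, adding the two divisibilities gives that 2 divides -1, hence 2 divides
  -- the natural number 1.
  k≢s refl = contradiction
    (∣⇒∣ᵤ (subst (+ 2 ∣_) (trans (telescope s d (+ k)) (cong (ℤ._- 1ℤ) (ℤₚ.+-inverseʳ (+ k))))
      (∣m∣n⇒∣m+n 2∣s-1-d 2∣d-k)))
    (>⇒∤ (s≤s (s≤s z≤n)))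

-- The bound in integers, with the denominator cleared.

module _ (k : ℕ) (G : Graph) where

  private
    D : V G → ℤ
    D u = + degree G u

  -- f(N[v]) is a sum of 1 + deg v odd terms: `v` itself, split off by `sumOver-N[]`, and its
  -- neighbors. This supplies the parity condition of `k+I≤`.
  k+I≤sumOver-N[] : ∀ f → SignedDominating k G f → ∀ v →
    + k ℤ.+ I k (D v) ℤ.≤ sumOver (N[_] G v) (value ∘ f)
  k+I≤sumOver-N[] f dom v = k+I≤ k (D v) _ (dom v)
    (subst (λ s → + 2 ∣ s ℤ.- ℤ.suc (D v)) (sym (sumOver-N[] G v (value ∘ f)))
      (2∣-+ (value (f v)) 1ℤ (sumOver (N G v) (value ∘ f)) (+ degree G v)
        (2∣value-1 (f v)) (sumOver-parity (N G v) f)))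

  -- With d = deg u, the right side minus the left is exactly 2((Δ - I(Δ)) - (d - I(d))) for the
  -- sign +, and 2((d + I(d)) - (δ + I(δ))) for the sign -. Each `identity` verifies this by ring
  -- algebra, and monotonicity makes the difference nonnegative. The factor `1ℤ` matches the shape
  -- of `sum-linear`.
  numerator≤ : ∀ s u →
    1ℤ ℤ.* numerator k G ℤ.+ + 2 ℤ.* (value s ℤ.* ℤ.suc (D u)) ℤ.≤
    denominator k G ℤ.* value s ℤ.+ + 2 ℤ.* (+ k ℤ.+ I k (D u))
  numerator≤ Sign.+ u = ℤₚ.0≤i-j⇒j≤i (subst (0ℤ ℤ.≤_)
    (identity (+ δ G) (I k (+ δ G)) (+ Δ G) (I k (+ Δ G)) (+ k) (D u) (I k (D u)))
    (ℤₚ.*-monoˡ-≤-nonNeg (+ 2) (ℤₚ.i≤j⇒0≤j-i (-I-mono k (degree≤Δ G u)))))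
    where
    identity : ∀ a i b j c d e →
      + 2 ℤ.* ((b ℤ.- j) ℤ.- (d ℤ.- e)) ≡
      ((a ℤ.+ b ℤ.+ + 2 ℤ.+ i ℤ.- j) ℤ.* 1ℤ ℤ.+ + 2 ℤ.* (c ℤ.+ e)) ℤ.-
      (1ℤ ℤ.* (a ℤ.- b ℤ.+ + 2 ℤ.* c ℤ.+ i ℤ.+ j) ℤ.+ + 2 ℤ.* (1ℤ ℤ.* (1ℤ ℤ.+ d)))
    identity = solve-∀
  numerator≤ Sign.- u = ℤₚ.0≤i-j⇒j≤i (subst (0ℤ ℤ.≤_)
    (identity (+ δ G) (I k (+ δ G)) (+ Δ G) (I k (+ Δ G)) (+ k) (D u) (I k (D u)))
    (ℤₚ.*-monoˡ-≤-nonNeg (+ 2) (ℤₚ.i≤j⇒0≤j-i (+I-mono k (δ≤degree G u)))))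
    where
    identity : ∀ a i b j c d e →
      + 2 ℤ.* ((d ℤ.+ e) ℤ.- (a ℤ.+ i)) ≡
      ((a ℤ.+ b ℤ.+ + 2 ℤ.+ i ℤ.- j) ℤ.* (ℤ.- 1ℤ) ℤ.+ + 2 ℤ.* (c ℤ.+ e)) ℤ.-
      (1ℤ ℤ.* (a ℤ.- b ℤ.+ + 2 ℤ.* c ℤ.+ i ℤ.+ j) ℤ.+ + 2 ℤ.* (ℤ.- 1ℤ ℤ.* (1ℤ ℤ.+ d)))
    identity = solve-∀

  -- The term `+ 2 ℤ.* sum a` is added to both sides and cancelled at the end. On the left it enters
  -- through the vertexwise inequality; on the right it returns because `sum b` is at most the sum
  -- of all f(N[v]), which equals `sum a` by double counting.
  order*numerator≤denominator*weight : ∀ f → SignedDominating k G f →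
    + order G ℤ.* numerator k G ℤ.≤ denominator k G ℤ.* weight f
  order*numerator≤denominator*weight f dom = cancelʳ (begin
    + order G ℤ.* numerator k G ℤ.+ + 2 ℤ.* sum a
      ≡⟨ cong (λ t → t ℤ.+ + 2 ℤ.* sum a) (trans (sym (sum-const (order G) (numerator k G))) (sym (ℤₚ.*-identityˡ _))) ⟩
    1ℤ ℤ.* ∑[ u < order G ] numerator k G ℤ.+ + 2 ℤ.* sum a
      ≡⟨ sum-linear 1ℤ (+ 2) (λ _ → numerator k G) a ⟨
    ∑[ u < order G ] (1ℤ ℤ.* numerator k G ℤ.+ + 2 ℤ.* a u)
      ≤⟨ sum-mono (λ u → numerator≤ (f u) u) ⟩
    ∑[ u < order G ] (denominator k G ℤ.* value (f u) ℤ.+ + 2 ℤ.* b u)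
      ≡⟨ sum-linear (denominator k G) (+ 2) (value ∘ f) b ⟩
    denominator k G ℤ.* weight f ℤ.+ + 2 ℤ.* sum b
      ≤⟨ ℤₚ.+-monoʳ-≤ (denominator k G ℤ.* weight f)
           (ℤₚ.*-monoˡ-≤-nonNeg (+ 2) (sum-mono (k+I≤sumOver-N[] f dom))) ⟩
    denominator k G ℤ.* weight f ℤ.+ + 2 ℤ.* ∑[ v < order G ] sumOver (N[_] G v) (value ∘ f)
      ≡⟨ cong (λ t → denominator k G ℤ.* weight f ℤ.+ + 2 ℤ.* t) (sum-N[] G (value ∘ f)) ⟩
    denominator k G ℤ.* weight f ℤ.+ + 2 ℤ.* sum a ∎)
    where
    open ℤₚ.≤-Reasoning
    a b : V G → ℤ
    a u = value (f u) ℤ.* ℤ.suc (D u)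
    b u = + k ℤ.+ I k (D u)
    cancelʳ : ∀ {x y z} → x ℤ.+ z ℤ.≤ y ℤ.+ z → x ℤ.≤ y
    cancelʳ {x} {y} {z} p = subst₂ ℤ._≤_ (undo x z) (undo y z) (ℤₚ.+-monoˡ-≤ (ℤ.- z) p)
      where
      undo : ∀ x z → (x ℤ.+ z) ℤ.- z ≡ x
      undo = solve-∀

  -- δ + Δ + 2 is at least 2, I(δ) is nonnegative, and subtracting I(Δ) costs at most 1.
  denominator-positive : 1ℤ ℤ.≤ denominator k G
  denominator-positive = ℤₚ.+-mono-≤
    (ℤₚ.+-mono-≤ (ℤ.+≤+ (ℕₚ.m≤n+m 2 (δ G ℕ.+ Δ G))) (0≤I k (+ δ G)))
    (ℤₚ.neg-mono-≤ (I≤1 k (+ Δ G)))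

-- Passage from integers to rationals.

toℚᵘ-fromℤ : ∀ i → ℚ.toℚᵘ (fromℤ i) ℚᵘ.≃ mkℚᵘ i 0
-- `fromℤ i` is put in lowest terms, which does not compute for a variable `i`, so order and
-- products are compared among unnormalised fractions. The 0 in `mkℚᵘ i 0` is the denominator minus
-- one.
toℚᵘ-fromℤ i = ℚₚ.toℚᵘ-fromℚᵘ (mkℚᵘ i 0)

fromℤ-mono-≤ : ∀ {i j} → i ℤ.≤ j → fromℤ i ℚ.≤ fromℤ j
fromℤ-mono-≤ {i} {j} i≤j = ℚₚ.toℚᵘ-cancel-≤ (begin
  ℚ.toℚᵘ (fromℤ i) ≃⟨ toℚᵘ-fromℤ i ⟩
  mkℚᵘ i 0         ≤⟨ *≤* (ℤₚ.*-monoʳ-≤-nonNeg 1ℤ i≤j) ⟩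
  mkℚᵘ j 0         ≃⟨ toℚᵘ-fromℤ j ⟨
  ℚ.toℚᵘ (fromℤ j) ∎)
  where open ℚᵘₚ.≤-Reasoning

fromℤ-homo-* : ∀ i j → fromℤ (i ℤ.* j) ≡ fromℤ i * fromℤ j
fromℤ-homo-* i j = ℚₚ.toℚᵘ-injective (begin-equality
  ℚ.toℚᵘ (fromℤ (i ℤ.* j))                  ≃⟨ toℚᵘ-fromℤ (i ℤ.* j) ⟩
  mkℚᵘ i 0 ℚᵘ.* mkℚᵘ j 0                    ≃⟨ ℚᵘₚ.*-cong (toℚᵘ-fromℤ i) (toℚᵘ-fromℤ j) ⟨
  ℚ.toℚᵘ (fromℤ i) ℚᵘ.* ℚ.toℚᵘ (fromℤ j)    ≃⟨ ℚₚ.toℚᵘ-homo-* (fromℤ i) (fromℤ j) ⟨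
  ℚ.toℚᵘ (fromℤ i * fromℤ j)                ∎)
  where open ℚᵘₚ.≤-Reasoning

fromℤ-positive : ∀ i → 1ℤ ℤ.≤ i → ℚ.Positive (fromℤ i)
fromℤ-positive (+ ℕ.suc n) _ = ℚₚ.normalize-pos (ℕ.suc n) 1
fromℤ-positive (+ ℕ.zero) (ℤ.+≤+ ())

-- Multiplying both sides by the positive `fromℤ d` cancels the division and leaves the image of the
-- integer inequality under `fromℤ`.
fromℤ-*-÷-≤ : ∀ n a d w .{{_ : ℚ.NonZero (fromℤ d)}} → 1ℤ ℤ.≤ d →
  n ℤ.* a ℤ.≤ d ℤ.* w → fromℤ n * (fromℤ a ÷ fromℤ d) ℚ.≤ fromℤ w
fromℤ-*-÷-≤ n a d w 1≤d na≤dw =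
  ℚₚ.*-cancelʳ-≤-pos (fromℤ d) {{fromℤ-positive d 1≤d}} (begin
    fromℤ n * (fromℤ a ÷ fromℤ d) * fromℤ d          ≡⟨ ℚₚ.*-assoc (fromℤ n) _ (fromℤ d) ⟩
    fromℤ n * ((fromℤ a ÷ fromℤ d) * fromℤ d)        ≡⟨ cong (fromℤ n *_) (ℚₚ.*-assoc (fromℤ a) _ (fromℤ d)) ⟩
    fromℤ n * (fromℤ a * (ℚ.1/ fromℤ d * fromℤ d))   ≡⟨ cong (λ x → fromℤ n * (fromℤ a * x)) (ℚₚ.*-inverseˡ (fromℤ d)) ⟩
    fromℤ n * (fromℤ a * ℚ.1ℚ)                       ≡⟨ cong (fromℤ n *_) (ℚₚ.*-identityʳ (fromℤ a)) ⟩
    fromℤ n * fromℤ a                                ≡⟨ fromℤ-homo-* n a ⟨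
    fromℤ (n ℤ.* a)                                  ≤⟨ fromℤ-mono-≤ na≤dw ⟩
    fromℤ (d ℤ.* w)                                  ≡⟨ cong fromℤ (ℤₚ.*-comm d w) ⟩
    fromℤ (w ℤ.* d)                                  ≡⟨ fromℤ-homo-* w d ⟩
    fromℤ w * fromℤ d                                ∎)
  where open ℚₚ.≤-Reasoning

-- The minimum is attained, so the integer bound at a dominating function of weight `g` is the bound
-- for `g`.
order*numerator÷denominator≤ : ∀ k G g → IsSignedDominationNumber k G g →
  fromℤ (+ order G) * _÷_ (fromℤ (numerator k G)) (fromℤ (denominator k G)) {{denominator-nonZero k G}}
  ℚ.≤ fromℤ g
order*numerator÷denominator≤ k G g ((f , dom , g≡w) , _) =
  fromℤ-*-÷-≤ (+ order G) (numerator k G) (denominator k G) g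
    {{denominator-nonZero k G}} (denominator-positive k G)
    (subst (λ w → + order G ℤ.* numerator k G ℤ.≤ denominator k G ℤ.* w) (sym g≡w)
      (order*numerator≤denominator*weight k G f dom))

theorem4 : (k : ℕ) → 1 ≤ k → (G : Graph) → (h : k ∸ 1 ≤ δ G) →
    fromℤ (γ k G h) ≥ fromℤ (+ order G) *
    _÷_ (fromℤ (numerator k G)) (fromℤ (denominator k G)) {{denominator-nonZero k G}}
theorem4 k _ G h = order*numerator÷denominator≤ k G (γ k G h) (γ-isSignedDominationNumber k G h)
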